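{- Let $\alpha\geq 2$, $k\geq 3$ be integers with $k\geq\alpha$. Then $$f(\alpha+k,\alpha,k)=\alpha k+m(k,k-\alpha).$$ Equivalently, $$f(\alpha+k,\alpha,k)=\begin{cases} k^2,&\alpha=k,\\ k^2-1,&\alpha=k-1,\\ \left\lceil\dfrac{k(\alpha+k)}{2}\right\rceil,&2\leq\alpha\leq k-2.\end{cases}$$
   Context: All graphs are finite, simple, and undirected. A graph is $k$-connected if it has more than $k$ vertices and deleting any set of fewer than $k$ vertices leaves a connected graph. The independence number of a graph is the maximum cardinality of a set of pairwise nonadjacent vertices; the size of a graph is its number of edges. For integers $n,\alpha,k$ for which the class of $k$-connected graphs of order $n$ and independence number (exactly) $\alpha$ is nonempty, $f(n,\alpha,k)$ denotes the minimum size of a graph in this class. For integers $p\geq 2$ and $0\leq d\leq p-1$, $m(p,d)$ denotes the minimum size of a graph of order $p$ that is $d$-connected, with the convention that no condition is imposed when $d=0$ (so $m(p,0)=0$). -}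

module Defs where

open import Data.Nat using (ℕ; zero; suc; _≤_; _<_)
open import Data.Fin using (Fin)
import Data.Fin as Fin
open import Data.Fin.Subset using (Subset; _∈_; _∉_; ∣_∣)
open import Data.List using (List; length; filter; allFin; cartesianProduct)
open import Data.Product using (_×_; _,_; ∃-syntax)
open import Data.Unit using (⊤)
open import Level using (0ℓ)
open import Relation.Binary using (Rel; Symmetric; Decidable)
open import Relation.Binary.Construct.Closure.ReflexiveTransitive using (Star)
open import Relation.Binary.PropositionalEquality using (_≡_)
open import Relation.Nullary using (¬_)
open import Relation.Nullary.Decidable using (_×-dec_)

-- A finite simple graph of order n, with vertex set Fin n.
record Graph (n : ℕ) : Set₁ where
  field
    Adj    : Rel (Fin n) 0ℓ
    adj?   : Decidable Adj
    sym    : Symmetric Adj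
    irrefl : ∀ {v} → ¬ Adj v v

module _ {n : ℕ} (G : Graph n) where
  open Graph G

  -- Each edge is listed once, as the pair (i , j) with i < j.
  edges : List (Fin n × Fin n)
  edges = filter (λ (i , j) → (i Fin.<? j) ×-dec adj? i j)
                 (cartesianProduct (allFin n) (allFin n))

  size : ℕ
  size = length edges

  -- Adjacency in the graph G - S.
  AdjOutside : Subset n → Rel (Fin n) 0ℓ
  AdjOutside S u v = u ∉ S × v ∉ S × Adj u v

  ConnectedOutside : Subset n → Set
  ConnectedOutside S = ∀ u v → u ∉ S → v ∉ S → Star (AdjOutside S) u v

  -- In this definition ∣ S ∣ < k < n, so G - S always has a vertex and the
  -- convention on connectedness of the empty graph plays no role.
  Connected[_] : ℕ → Set
  Connected[ k ] = k < n × (∀ (S : Subset n) → ∣ S ∣ < k → ConnectedOutside S)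

  Independent : Subset n → Set
  Independent S = ∀ {u v} → u ∈ S → v ∈ S → ¬ Adj u v

  IndependenceNumber : ℕ → Set
  IndependenceNumber α =
    (∃[ S ] Independent S × ∣ S ∣ ≡ α) ×
    (∀ (S : Subset n) → Independent S → ∣ S ∣ ≤ α)

-- s is the minimum size of a graph in the class P; in particular P is nonempty.
MinimumSize : ∀ {n} → (Graph n → Set) → ℕ → Set₁
MinimumSize P s = (∃[ G ] P G × size G ≡ s) × (∀ G → P G → s ≤ size G)

-- The functions f and m are given by their graphs: f[ n , α , k ]= s says
-- that f(n, α, k) is defined and equal to s, and similarly for m.
f[_,_,_]=_ : ℕ → ℕ → ℕ → ℕ → Set₁
f[ n , α , k ]= s =
  MinimumSize {n} (λ G → Connected[_] G k × IndependenceNumber G α) s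

-- d-connectedness, with no condition imposed when d = 0.
Connected₀ : ∀ {p} → ℕ → Graph p → Set
Connected₀ zero      G = ⊤
Connected₀ d@(suc _) G = Connected[_] G d

m[_,_]=_ : ℕ → ℕ → ℕ → Set₁
m[ p , d ]= s = MinimumSize {p} (Connected₀ d) s

{-# OPTIONS --safe #-}
module Submission where

-- Write k = α + d. In a k-connected graph every degree is at least k, which gives both lower
-- bounds ⌈nk/2⌉ and, since an independent set avoids the neighbourhood of its members, the
-- bound n - k on the independence number. Only d = 1 needs more: deleting an independent set S
-- of size α < k leaves a connected graph, so at least α edges besides the ≥ αk edges meeting S.
--
-- For the upper bounds, the join of α isolated vertices with a d-connected graph on k vertices
-- is k-connected, so it suffices to find d-connected graphs with few edges: a star for d = 1,
-- and for d = 2r or 2r + 1 the circulant graph with steps 1, …, r on the cycle of length p, plus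
-- for odd d the chords {i , i + ⌊p/2⌋}. If deleting a set separates u from v, each of the two
-- arcs between them contains r consecutive deleted vertices; this is impossible when fewer than
-- 2r are deleted, and when exactly 2r are, the two surviving arcs are intact and the chord at
-- the last vertex of the shorter one lands in the other.

open import Data.Bool using (Bool; true; false; if_then_else_)
open import Data.Empty using (⊥-elim)
open import Data.Fin as Fin using (Fin; zero; suc; toℕ; fromℕ<; splitAt; _↑ˡ_; _↑ʳ_)
import Data.Fin.Properties as Fin
open import Data.Fin.Subset using (Subset; _∈_; _∉_; _⊆_; ∣_∣; ∁; ⁅_⁆; ⊥; ⊤; inside; outside)
open import Data.Fin.Subset.Properties
  using (_∈?_; nonempty?; Empty-unique; p⊆q⇒∣p∣≤∣q∣; ∣∁p∣≡n∸∣p∣; ∣⁅x⁆∣≡1; ∣⊥∣≡0; ∣⊤∣≡n; ∉⊥;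
         x∉p⇒x∈∁p; x∈∁p⇒x∉p; x∈⁅x⁆; x∈p⇒∣p-x∣<∣p∣)
open import Data.List
  using (List; []; _∷_; length; map; filter; tabulate; allFin; cartesianProduct; cartesianProductWith)
  renaming (_++_ to _++ᴸ_)
import Data.List.Membership.DecPropositional as DecMembership
open import Data.List.Membership.Propositional using () renaming (_∈_ to _∈ᴸ_)
open import Data.List.Membership.Propositional.Properties
  using (∈-∃++; ∈-++⁺ˡ; ∈-++⁺ʳ; ∈-++⁻; ∈-filter⁺; ∈-filter⁻; ∈-allFin; ∈-map⁺; ∈-map⁻;
         ∈-cartesianProduct⁺; ∈-cartesianProductWith⁺; ∈-cartesianProductWith⁻)
open import Data.List.Properties using (filter-++; length-++; length-map; length-tabulate)
import Data.List.Relation.Unary.All as All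
open import Data.List.Relation.Unary.AllPairs using (_∷_)
open import Data.List.Relation.Unary.Any using (here; there)
open import Data.List.Relation.Unary.Unique.Propositional using (Unique)
import Data.List.Relation.Unary.Unique.Propositional.Properties as Unique
open import Data.Nat
open import Data.Nat.DivMod
open import Data.Nat.Properties
open import Data.Nat.Tactic.RingSolver using (solve-∀)
open import Data.Product as Product using (_×_; _,_; ∃-syntax; ∃₂; proj₁; proj₂)
open import Data.Product.Properties using (≡-dec)
open import Data.Sum as Sum using (_⊎_; inj₁; inj₂; [_,_]′)
open import Data.Unit using (tt)
open import Data.Vec as Vec using ([]; _∷_; _++_; lookup)
open import Data.Vec.Properties using ([]=⇒lookup; lookup⇒[]=; lookup∘tabulate; lookup-++ˡ; lookup-++ʳ)
open import Function using (_∘_)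
open import Level using (0ℓ)
open import Relation.Binary.Construct.Closure.ReflexiveTransitive using (Star; ε; _◅_; _◅◅_; reverse; gmap)
open import Relation.Binary.Definitions using (tri<; tri≈; tri>)
open import Relation.Binary.PropositionalEquality
open import Relation.Nullary
open import Relation.Nullary.Decidable using (_×-dec_; _⊎-dec_; dec-true; dec-false)
open import Relation.Unary using (Pred; Decidable)
open import Algebra.Properties.CommutativeMonoid.Sum +-0-commutativeMonoid
  using (sum; sum-syntax; sum-cong-≗; ∑-distrib-+; ∑-comm)
open import Defs

private variable
  n : ℕ

-- Counting

bit : Bool → ℕ
bit b = if b then 1 else 0

-- Iverson bracket: it turns lengths of filtered lists into double sums, which can be rearranged.
⟦_⟧ : ∀ {P : Set} → Dec P → ℕ
⟦ p? ⟧ = bit (does p?)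

sum-mono-≤ : ∀ {n} {f g : Fin n → ℕ} → (∀ i → f i ≤ g i) → sum f ≤ sum g
sum-mono-≤ {zero}  f≤g = z≤n
sum-mono-≤ {suc n} f≤g = +-mono-≤ (f≤g zero) (sum-mono-≤ (f≤g ∘ suc))

sum-≥-const : ∀ {n} {f : Fin n → ℕ} c → (∀ i → c ≤ f i) → n * c ≤ sum f
sum-≥-const {zero}  c c≤f = z≤n
sum-≥-const {suc n} c c≤f = +-mono-≤ (c≤f zero) (sum-≥-const c (c≤f ∘ suc))

*-distribʳ-sum : ∀ {n} (f : Fin n → ℕ) c → sum (λ i → f i * c) ≡ sum f * c
*-distribʳ-sum {zero}  f c = refl
*-distribʳ-sum {suc n} f c =
  trans (cong (f zero * c +_) (*-distribʳ-sum (f ∘ suc) c))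
        (sym (*-distribʳ-+ c (f zero) (sum (f ∘ suc))))

∣_∣≡sum : (S : Subset n) → ∣ S ∣ ≡ ∑[ i < n ] bit (lookup S i)
∣ [] ∣≡sum          = refl
∣ inside  ∷ S ∣≡sum = cong suc ∣ S ∣≡sum
∣ outside ∷ S ∣≡sum = ∣ S ∣≡sum

∈?⟦⟧ : ∀ (S : Subset n) i → ⟦ i ∈? S ⟧ ≡ bit (lookup S i)
∈?⟦⟧ S i with i ∈? S
... | yes i∈S = cong bit (sym ([]=⇒lookup i∈S))
... | no  i∉S with lookup S i in eq
...   | true  = ⊥-elim (i∉S (lookup⇒[]= i S eq))
...   | false = refl

module _ {A : Set} {P : Pred A 0ℓ} (P? : Decidable P) where

  length-filter-tabulate : ∀ {n} (f : Fin n → A) →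
    length (filter P? (tabulate f)) ≡ ∑[ i < n ] ⟦ P? (f i) ⟧
  length-filter-tabulate {zero}  f = refl
  length-filter-tabulate {suc n} f with does (P? (f zero))
  ... | true  = cong suc (length-filter-tabulate (f ∘ suc))
  ... | false = length-filter-tabulate (f ∘ suc)

  length-filter-map : ∀ {B : Set} (f : B → A) xs →
    length (filter P? (map f xs)) ≡ length (filter (P? ∘ f) xs)
  length-filter-map f []       = refl
  length-filter-map f (x ∷ xs) with does (P? (f x))
  ... | true  = cong suc (length-filter-map f xs)
  ... | false = length-filter-map f xs

module _ {A B : Set} {P : Pred (A × B) 0ℓ} (P? : Decidable P) where

  length-filter-cartesianProduct : ∀ {n} (f : Fin n → A) ys →
    length (filter P? (cartesianProduct (tabulate f) ys)) ≡
    ∑[ i < n ] length (filter (λ y → P? (f i , y)) ys)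
  length-filter-cartesianProduct {zero}  f ys = refl
  length-filter-cartesianProduct {suc n} f ys = begin
    length (filter P? (map (f zero ,_) ys ++ᴸ zs))
      ≡⟨ cong length (filter-++ P? (map (f zero ,_) ys) zs) ⟩
    length (filter P? (map (f zero ,_) ys) ++ᴸ filter P? zs)
      ≡⟨ length-++ (filter P? (map (f zero ,_) ys)) ⟩
    length (filter P? (map (f zero ,_) ys)) + length (filter P? zs)
      ≡⟨ cong₂ _+_ (length-filter-map P? (f zero ,_) ys) (length-filter-cartesianProduct (f ∘ suc) ys) ⟩
    _ ∎
    where
    open ≡-Reasoning
    zs = cartesianProduct (tabulate (f ∘ suc)) ys

length-filter-pairs : ∀ {n} {P : Pred (Fin n × Fin n) 0ℓ} (P? : Decidable P) →
  length (filter P? (cartesianProduct (allFin n) (allFin n))) ≡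
  ∑[ i < n ] ∑[ j < n ] ⟦ P? (i , j) ⟧
length-filter-pairs P? =
  trans (length-filter-cartesianProduct P? (λ i → i) _)
        (sum-cong-≗ λ i → length-filter-tabulate (λ j → P? (i , j)) (λ j → j))

∑∑-distrib-+ : (F G : Fin n → Fin n → ℕ) →
  ∑[ i < n ] ∑[ j < n ] (F i j + G i j) ≡
  ∑[ i < n ] ∑[ j < n ] F i j + ∑[ i < n ] ∑[ j < n ] G i j
∑∑-distrib-+ F G = trans (sum-cong-≗ λ i → ∑-distrib-+ (F i) (G i))
                         (∑-distrib-+ (λ i → sum (F i)) (λ i → sum (G i)))

-- Off the diagonal exactly one of `i < j` and `j < i` holds. Split `F i j` accordingly and exchange
-- the order of summation in the half with `j < i`. This turns counts over ordered pairs into counts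
-- over edges.
∑∑-fold : (F : Fin n → Fin n → ℕ) → (∀ i → F i i ≡ 0) →
  ∑[ i < n ] ∑[ j < n ] F i j ≡
  ∑[ i < n ] ∑[ j < n ] (⟦ i Fin.<? j ⟧ * (F i j + F j i))
∑∑-fold {n} F F-diag = begin
  ∑[ i < n ] ∑[ j < n ] F i j
    ≡⟨ (sum-cong-≗ λ i → sum-cong-≗ λ j → split i j) ⟩
  ∑[ i < n ] ∑[ j < n ] (L i j * F i j + L j i * F i j)
    ≡⟨ ∑∑-distrib-+ (λ i j → L i j * F i j) (λ i j → L j i * F i j) ⟩
  ∑[ i < n ] ∑[ j < n ] (L i j * F i j) + ∑[ i < n ] ∑[ j < n ] (L j i * F i j)
    ≡⟨ cong (sum (λ i → sum λ j → L i j * F i j) +_) (∑-comm (λ i j → L j i * F i j)) ⟩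
  ∑[ i < n ] ∑[ j < n ] (L i j * F i j) + ∑[ i < n ] ∑[ j < n ] (L i j * F j i)
    ≡⟨ ∑∑-distrib-+ (λ i j → L i j * F i j) (λ i j → L i j * F j i) ⟨
  ∑[ i < n ] ∑[ j < n ] (L i j * F i j + L i j * F j i)
    ≡⟨ (sum-cong-≗ λ i → sum-cong-≗ λ j → *-distribˡ-+ (L i j) (F i j) (F j i)) ⟨
  ∑[ i < n ] ∑[ j < n ] (L i j * (F i j + F j i)) ∎
  where
  open ≡-Reasoning
  L : Fin n → Fin n → ℕ
  L i j = ⟦ i Fin.<? j ⟧
  split : ∀ i j → F i j ≡ L i j * F i j + L j i * F i j
  split i j with Fin.<-cmp i j
  ... | tri< i<j _ j≮i rewrite dec-true (i Fin.<? j) i<j | dec-false (j Fin.<? i) j≮i =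
    sym (trans (+-identityʳ _) (+-identityʳ _))
  ... | tri≈ i≮j refl _ rewrite dec-false (i Fin.<? i) i≮j = F-diag i
  ... | tri> i≮j _ j<i rewrite dec-true (j Fin.<? i) j<i | dec-false (i Fin.<? j) i≮j =
    sym (+-identityʳ _)

-- Degrees in k-connected graphs

module _ (G : Graph n) where
  open Graph G renaming (sym to Adj-sym)

  N : Fin n → Subset n
  N v = Vec.tabulate λ w → does (adj? v w)

  ∈N⁺ : ∀ {v w} → Adj v w → w ∈ N v
  ∈N⁺ {v} {w} vw = lookup⇒[]= w (N v) (trans (lookup∘tabulate _ w) (dec-true (adj? v w) vw))

  ∈N⁻ : ∀ {v w} → w ∈ N v → Adj v w
  ∈N⁻ {v} {w} w∈N with adj? v w | trans (sym (lookup∘tabulate (λ w → does (adj? v w)) w)) ([]=⇒lookup w∈N)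
  ... | yes vw | _ = vw

  deg : Fin n → ℕ
  deg v = ∣ N v ∣

  deg≡sum : ∀ v → deg v ≡ ∑[ w < n ] ⟦ adj? v w ⟧
  deg≡sum v = trans ∣ N v ∣≡sum (sum-cong-≗ λ w → cong bit (lookup∘tabulate (λ w → does (adj? v w)) w))

  adj?-sym : ∀ v w → ⟦ adj? v w ⟧ ≡ ⟦ adj? w v ⟧
  adj?-sym v w with adj? v w | adj? w v
  ... | yes _  | yes _  = refl
  ... | no  _  | no _   = refl
  ... | yes vw | no ¬wv = ⊥-elim (¬wv (Adj-sym vw))
  ... | no ¬vw | yes wv = ⊥-elim (¬vw (Adj-sym wv))

  adj?-diag : ∀ v → ⟦ adj? v v ⟧ ≡ 0
  adj?-diag v = cong bit (dec-false (adj? v v) irrefl)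

  size≡sum : size G ≡ ∑[ i < n ] ∑[ j < n ] ⟦ (i Fin.<? j) ×-dec adj? i j ⟧
  size≡sum = length-filter-pairs λ (i , j) → (i Fin.<? j) ×-dec adj? i j

  handshake : ∑[ v < n ] deg v ≡ size G + size G
  handshake = begin
    ∑[ v < n ] deg v
      ≡⟨ sum-cong-≗ deg≡sum ⟩
    ∑[ v < n ] ∑[ w < n ] ⟦ adj? v w ⟧
      ≡⟨ ∑∑-fold (λ v w → ⟦ adj? v w ⟧) adj?-diag ⟩
    ∑[ v < n ] ∑[ w < n ] (⟦ v Fin.<? w ⟧ * (⟦ adj? v w ⟧ + ⟦ adj? w v ⟧))
      ≡⟨ (sum-cong-≗ λ v → sum-cong-≗ λ w → twice v w) ⟩
    ∑[ v < n ] ∑[ w < n ] (E v w + E v w)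
      ≡⟨ ∑∑-distrib-+ E E ⟩
    sum (λ v → sum (E v)) + sum (λ v → sum (E v))
      ≡⟨ cong₂ _+_ size≡sum size≡sum ⟨
    size G + size G ∎
    where
    open ≡-Reasoning
    E : Fin n → Fin n → ℕ
    E v w = ⟦ (v Fin.<? w) ×-dec adj? v w ⟧
    twice : ∀ v w → ⟦ v Fin.<? w ⟧ * (⟦ adj? v w ⟧ + ⟦ adj? w v ⟧) ≡ E v w + E v w
    twice v w rewrite adj?-sym w v with does (v Fin.<? w) | does (adj? v w)
    ... | false | _     = refl
    ... | true  | false = refl
    ... | true  | true  = refl

  -- Deleting the neighbourhood of v isolates v.
  k≤deg : ∀ {k} → Connected[_] G k → ∀ v → k ≤ deg v
  k≤deg {k} (k<n , conn) v with k ≤? deg v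
  ... | yes k≤deg = k≤deg
  ... | no  k≰deg = ⊥-elim (stuck far)
    where
    v∉N : v ∉ N v
    v∉N v∈N = irrefl (∈N⁻ v∈N)
    -- A second vertex survives the deletion: otherwise only `v` lies outside `N v`, and n ≤ deg v +
    -- 1 ≤ k contradicts k < n.
    far : ∃[ w ] w ∉ N v × w ≢ v
    far with Fin.any? (λ w → ¬? (w ∈? N v) ×-dec ¬? (w Fin.≟ v))
    ... | yes found = found
    ... | no  none  = ⊥-elim (<⇒≱ k<n n≤k)
      where
      others : ∁ (N v) ⊆ ⁅ v ⁆
      others {w} w∈∁N with w Fin.≟ v
      ... | yes refl = x∈⁅x⁆ v
      ... | no w≢v   = ⊥-elim (none (w , x∈∁p⇒x∉p w∈∁N , w≢v))
      n≤k : n ≤ k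
      n≤k = begin
        n                       ≤⟨ m≤n+m∸n n (deg v) ⟩
        deg v + (n ∸ deg v)     ≡⟨ cong (deg v +_) (∣∁p∣≡n∸∣p∣ (N v)) ⟨
        deg v + ∣ ∁ (N v) ∣     ≤⟨ +-monoʳ-≤ (deg v) (p⊆q⇒∣p∣≤∣q∣ others) ⟩
        deg v + ∣ ⁅ v ⁆ ∣       ≡⟨ cong (deg v +_) (∣⁅x⁆∣≡1 v) ⟩
        deg v + 1               ≡⟨ +-comm (deg v) 1 ⟩
        suc (deg v)             ≤⟨ ≰⇒> k≰deg ⟩
        k                       ∎
        where open ≤-Reasoning
    stuck : ¬ (∃[ w ] w ∉ N v × w ≢ v)
    stuck (w , w∉N , w≢v) with conn (N v) (≰⇒> k≰deg) v w v∉N w∉N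
    ... | ε = w≢v refl
    ... | (_ , x∉N , vx) ◅ _ = x∉N (∈N⁺ vx)

  -- The degree sum is at least nk and equals twice the size; rounding up is free because the size
  -- is an integer.
  ⌈nk/2⌉≤size : ∀ {k} → Connected[_] G k → ⌈ n * k /2⌉ ≤ size G
  ⌈nk/2⌉≤size {k} conn = begin
    ⌈ n * k /2⌉            ≤⟨ ⌈n/2⌉-mono (sum-≥-const k (k≤deg conn)) ⟩
    ⌈ sum deg /2⌉          ≡⟨ cong ⌈_/2⌉ handshake ⟩
    ⌈ size G + size G /2⌉  ≡⟨ n≡⌈n+n/2⌉ (size G) ⟨
    size G                 ∎
    where open ≤-Reasoning

  independent⇒≤n∸k : ∀ {k} → Connected[_] G k → ∀ S → Independent G S → ∣ S ∣ ≤ n ∸ k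
  independent⇒≤n∸k {k} conn S indep with nonempty? S
  ... | no empty rewrite Empty-unique empty | ∣⊥∣≡0 n = z≤n
  ... | yes (v , v∈S) = begin
    ∣ S ∣        ≤⟨ p⊆q⇒∣p∣≤∣q∣ (λ {w} w∈S → x∉p⇒x∈∁p λ w∈N → indep v∈S w∈S (∈N⁻ w∈N)) ⟩
    ∣ ∁ (N v) ∣  ≡⟨ ∣∁p∣≡n∸∣p∣ (N v) ⟩
    n ∸ deg v    ≤⟨ ∸-monoʳ-≤ n (k≤deg conn v) ⟩
    n ∸ k        ∎
    where open ≤-Reasoning

-- Components and lower bounds

-- Pigeonhole by induction: cut one occurrence of the head out of `ys`. The head does not recur in
-- `xs`, so the tail is still contained in what is left.
unique-⊆⇒length-≤ : ∀ {A : Set} {xs ys : List A} → Unique xs →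
  (∀ {x} → x ∈ᴸ xs → x ∈ᴸ ys) → length xs ≤ length ys
unique-⊆⇒length-≤ {xs = []} _ _ = z≤n
unique-⊆⇒length-≤ {xs = x ∷ xs} (x∉xs ∷ uniq) xs⊆ys with ∈-∃++ (xs⊆ys (here refl))
... | as , bs , refl = begin
  suc (length xs)                ≤⟨ s≤s (unique-⊆⇒length-≤ uniq rest) ⟩
  suc (length (as ++ᴸ bs))        ≡⟨ cong suc (length-++ as) ⟩
  suc (length as + length bs)    ≡⟨ +-suc (length as) (length bs) ⟨
  length as + suc (length bs)    ≡⟨ length-++ as ⟨
  length (as ++ᴸ x ∷ bs)          ∎
  where
  open ≤-Reasoning
  rest : ∀ {y} → y ∈ᴸ xs → y ∈ᴸ as ++ᴸ bs
  rest y∈xs with ∈-++⁻ as (xs⊆ys (there y∈xs))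
  ... | inj₁ y∈as             = ∈-++⁺ˡ y∈as
  ... | inj₂ (here refl)      = ⊥-elim (All.lookup x∉xs y∈xs refl)
  ... | inj₂ (there y∈bs)     = ∈-++⁺ʳ as y∈bs

elements : Subset n → List (Fin n)
elements S = filter (_∈? S) (allFin _)

length-elements : (S : Subset n) → length (elements S) ≡ ∣ S ∣
length-elements S = trans (length-filter-tabulate (_∈? S) (λ i → i))
  (trans (sum-cong-≗ (∈?⟦⟧ S)) (sym ∣ S ∣≡sum))

-- c names the components of the graph with edge list L; every component
-- counted by roots is named after one of its own vertices.
record Components (L : List (Fin n × Fin n)) : Set where
  field
    c       : Fin n → Fin n
    c-edge  : ∀ {u v} → (u , v) ∈ᴸ L → c u ≡ c v
    roots   : List (Fin n)
    unique  : Unique roots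
    c-root  : ∀ {x} → x ∈ᴸ roots → c x ≡ x
    many    : n ≤ length roots + length L

-- Edges are added one at a time. The edge from `u` to `v` renames the component `c u` to `c v`, so
-- at most the root `c u` is lost while the list grows by one. This root is dropped even if both
-- ends already share a component, which is harmless because `many` is only a lower bound.
components : (L : List (Fin n × Fin n)) → Components L
components {n} [] = record
  { c = λ x → x ; c-edge = λ () ; roots = allFin n ; unique = Unique.allFin⁺ n ; c-root = λ _ → refl
  ; many = ≤-reflexive (sym (trans (+-identityʳ _) (length-tabulate _))) }
components {n} ((u , v) ∷ L) = record
  { c = merge ∘ c ; c-edge = edge ; roots = filter other? roots
  ; unique = Unique.filter⁺ other? unique ; c-root = root ; many = many′ }
  where
  open Components (components L)
  other? : ∀ x → Dec (x ≢ c u)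
  other? x = ¬? (x Fin.≟ c u)
  merge : Fin n → Fin n
  merge x with x Fin.≟ c u
  ... | yes _ = c v
  ... | no _  = x
  merge-u : ∀ {x} → x ≡ c u → merge x ≡ c v
  merge-u {x} eq with x Fin.≟ c u
  ... | yes _ = refl
  ... | no x≢ = ⊥-elim (x≢ eq)
  merge-id : ∀ {x} → x ≢ c u → merge x ≡ x
  merge-id {x} x≢ with x Fin.≟ c u
  ... | yes eq = ⊥-elim (x≢ eq)
  ... | no _   = refl
  merge-v : merge (c v) ≡ c v
  merge-v with c v Fin.≟ c u
  ... | yes _ = refl
  ... | no _  = refl
  edge : ∀ {x y} → (x , y) ∈ᴸ (u , v) ∷ L → merge (c x) ≡ merge (c y)
  edge (here refl)  = trans (merge-u refl) (sym merge-v)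
  edge (there xy∈L) = cong merge (c-edge xy∈L)
  root : ∀ {x} → x ∈ᴸ filter other? roots → merge (c x) ≡ x
  root x∈ with ∈-filter⁻ other? {xs = roots} x∈
  ... | x∈roots , x≢ = trans (cong merge (c-root x∈roots)) (merge-id x≢)
  covered : ∀ {x} → x ∈ᴸ roots → x ∈ᴸ c u ∷ filter other? roots
  covered {x} x∈ with x Fin.≟ c u
  ... | yes refl = here refl
  ... | no x≢    = there (∈-filter⁺ other? x∈ x≢)
  many′ : n ≤ length (filter other? roots) + suc (length L)
  many′ = begin
    n                                                  ≤⟨ many ⟩
    length roots + length L                            ≤⟨ +-monoˡ-≤ (length L) (unique-⊆⇒length-≤ unique covered) ⟩
    suc (length (filter other? roots) + length L)      ≡⟨ +-suc _ _ ⟨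
    length (filter other? roots) + suc (length L)      ∎
    where open ≤-Reasoning

-- A spanning tree bound for G - S. Vertices outside `S` are joined by edges from `L`, hence share
-- one name, so at most one root lies outside `S`; the other roots lie in `S`. Now compare with
-- `many`.
connectedOutside⇒≤ : (G : Graph n) (S : Subset n) (L : List (Fin n × Fin n)) →
  ConnectedOutside G S → (∀ {u v} → AdjOutside G S u v → (u , v) ∈ᴸ L ⊎ (v , u) ∈ᴸ L) →
  n ≤ suc ∣ S ∣ + length L
connectedOutside⇒≤ {n} G S L conn listed = ≤-trans many (+-monoˡ-≤ (length L) few)
  where
  open Components (components L)
  c-path : ∀ {u v} → Star (AdjOutside G S) u v → c u ≡ c v
  c-path ε        = refl
  c-path (e ◅ es) = trans ([ c-edge , sym ∘ c-edge ]′ (listed e)) (c-path es)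
  few : length roots ≤ suc ∣ S ∣
  -- If some `a` outside `S` is its own name, every root outside `S` equals `a`. If there is none,
  -- all roots lie in `S`.
  few with Fin.any? (λ a → ¬? (a ∈? S) ×-dec (c a Fin.≟ a))
  ... | yes (a , a∉S , ca≡a) =
    ≤-trans (unique-⊆⇒length-≤ unique sub) (≤-reflexive (cong suc (length-elements S)))
    where
    sub : ∀ {x} → x ∈ᴸ roots → x ∈ᴸ a ∷ elements S
    sub {x} x∈ with x ∈? S
    ... | yes x∈S = there (∈-filter⁺ (_∈? S) (∈-allFin x) x∈S)
    ... | no x∉S  = here (trans (sym (c-root x∈)) (trans (c-path (conn x a x∉S a∉S)) ca≡a))
  ... | no none =
    m≤n⇒m≤1+n (≤-trans (unique-⊆⇒length-≤ unique sub) (≤-reflexive (length-elements S)))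
    where
    sub : ∀ {x} → x ∈ᴸ roots → x ∈ᴸ elements S
    sub {x} x∈ with x ∈? S
    ... | yes x∈S = ∈-filter⁺ (_∈? S) (∈-allFin x) x∈S
    ... | no x∉S  = ⊥-elim (none (x , x∉S , c-root x∈))

module _ (G : Graph n) where
  open Graph G renaming (sym to Adj-sym)

  module _ (S : Subset n) where

    edgesOutside? : (e : Fin n × Fin n) →
      Dec (let (i , j) = e in (i Fin.< j × Adj i j) × (i ∉ S × j ∉ S))
    edgesOutside? (i , j) = ((i Fin.<? j) ×-dec adj? i j) ×-dec (¬? (i ∈? S) ×-dec ¬? (j ∈? S))

    edgesOutside : List (Fin n × Fin n)
    edgesOutside = filter edgesOutside? (cartesianProduct (allFin n) (allFin n))

    edgesOutside-listed : ∀ {u v} → AdjOutside G S u v → (u , v) ∈ᴸ edgesOutside ⊎ (v , u) ∈ᴸ edgesOutside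
    edgesOutside-listed {u} {v} (u∉S , v∉S , uv) with Fin.<-cmp u v
    ... | tri< u<v _ _ = inj₁ (∈-filter⁺ edgesOutside? (∈-cartesianProduct⁺ (∈-allFin u) (∈-allFin v)) ((u<v , uv) , u∉S , v∉S))
    ... | tri≈ _ refl _ = ⊥-elim (irrefl uv)
    ... | tri> _ _ v<u = inj₂ (∈-filter⁺ edgesOutside? (∈-cartesianProduct⁺ (∈-allFin v) (∈-allFin u)) ((v<u , Adj-sym uv) , v∉S , u∉S))

    -- An edge has at most one end in an independent set, so summing the degrees over `S` counts
    -- each edge meeting `S` once. The edges counted by `edgesOutside` are disjoint from these.
    independent-size : ∀ {k} → Independent G S → (∀ v → k ≤ deg G v) →
      ∣ S ∣ * k + length edgesOutside ≤ size G
    independent-size {k} indep k≤deg = begin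
      ∣ S ∣ * k + length edgesOutside
        ≤⟨ +-mono-≤ touching (≤-reflexive (length-filter-pairs edgesOutside?)) ⟩
      sum (λ i → sum λ j → lt i j * (F i j + F j i)) + sum (λ i → sum λ j → ⟦ edgesOutside? (i , j) ⟧)
        ≡⟨ ∑∑-distrib-+ (λ i j → lt i j * (F i j + F j i)) (λ i j → ⟦ edgesOutside? (i , j) ⟧) ⟨
      ∑[ i < n ] ∑[ j < n ] (lt i j * (F i j + F j i) + ⟦ edgesOutside? (i , j) ⟧)
        ≤⟨ (sum-mono-≤ λ i → sum-mono-≤ λ j → split i j) ⟩
      ∑[ i < n ] ∑[ j < n ] ⟦ (i Fin.<? j) ×-dec adj? i j ⟧
        ≡⟨ size≡sum G ⟨
      size G ∎
      where
      open ≤-Reasoning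
      lt : Fin n → Fin n → ℕ
      lt i j = ⟦ i Fin.<? j ⟧
      -- `F i j` marks the ordered adjacent pairs whose first vertex is in `S`. Its total is the
      -- degree sum over `S`, and folding it to `i < j` charges each edge with its number of ends in
      -- `S`.
      F : Fin n → Fin n → ℕ
      F i j = ⟦ adj? i j ⟧ * ⟦ i ∈? S ⟧
      touching : ∣ S ∣ * k ≤ ∑[ i < n ] ∑[ j < n ] (lt i j * (F i j + F j i))
      touching = begin
        ∣ S ∣ * k                                     ≡⟨ cong (_* k) ∣ S ∣≡sum ⟩
        sum (λ i → bit (lookup S i)) * k              ≡⟨ *-distribʳ-sum (λ i → bit (lookup S i)) k ⟨
        ∑[ i < n ] (bit (lookup S i) * k)             ≤⟨ (sum-mono-≤ λ i → *-mono-≤ (≤-reflexive (sym (∈?⟦⟧ S i))) (k≤deg i)) ⟩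
        ∑[ i < n ] (⟦ i ∈? S ⟧ * deg G i)             ≡⟨ (sum-cong-≗ λ i → row i) ⟩
        ∑[ i < n ] ∑[ j < n ] F i j                   ≡⟨ ∑∑-fold F (λ i → cong (_* ⟦ i ∈? S ⟧) (adj?-diag G i)) ⟩
        ∑[ i < n ] ∑[ j < n ] (lt i j * (F i j + F j i)) ∎
        where
        row : ∀ i → ⟦ i ∈? S ⟧ * deg G i ≡ ∑[ j < n ] F i j
        row i = trans (*-comm ⟦ i ∈? S ⟧ (deg G i))
          (trans (cong (_* ⟦ i ∈? S ⟧) (deg≡sum G i)) (sym (*-distribʳ-sum (λ j → ⟦ adj? i j ⟧) ⟦ i ∈? S ⟧)))
      split : ∀ i j → lt i j * (F i j + F j i) + ⟦ edgesOutside? (i , j) ⟧ ≤ ⟦ (i Fin.<? j) ×-dec adj? i j ⟧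
      split i j rewrite adj?-sym G j i with does (i Fin.<? j) | adj? i j | i ∈? S | j ∈? S
      ... | false | _      | _       | _       = z≤n
      ... | true  | no _   | _       | _       = z≤n
      ... | true  | yes ij | yes i∈S | yes j∈S = ⊥-elim (indep i∈S j∈S ij)
      ... | true  | yes _  | yes _   | no _    = ≤-refl
      ... | true  | yes _  | no _    | yes _   = ≤-refl
      ... | true  | yes _  | no _    | no _    = ≤-refl

  -- The spanning tree bound with nothing deleted. Here `independent-size` is applied to the empty
  -- set with degree bound 0, merely to bound `edgesOutside ⊥` by the size.
  connected⇒n∸1≤size : Connected[_] G 1 → n ∸ 1 ≤ size G
  connected⇒n∸1≤size (_ , conn) = m≤n+o⇒m∸n≤o n 1 (begin
    n                                 ≤⟨ connectedOutside⇒≤ G ⊥ (edgesOutside ⊥) (conn ⊥ (s≤s (≤-reflexive (∣⊥∣≡0 n)))) (edgesOutside-listed ⊥) ⟩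
    suc ∣ ⊥ {n} ∣ + length (edgesOutside ⊥)  ≡⟨ cong (λ s → suc s + length (edgesOutside ⊥)) (∣⊥∣≡0 n) ⟩
    suc (length (edgesOutside ⊥))     ≤⟨ s≤s (≤-trans (m≤n+m _ _) (independent-size ⊥ {0} (λ v∈⊥ → ⊥-elim (∉⊥ v∈⊥)) λ _ → z≤n)) ⟩
    suc (size G)                      ∎)
    where open ≤-Reasoning

-- Graphs given by edge lists

fromList : List (Fin n × Fin n) → Graph n
fromList {n} L = record
  { Adj    = λ u v → u ≢ v × ((u , v) ∈ᴸ L ⊎ (v , u) ∈ᴸ L)
  ; adj?   = λ u v → ¬? (u Fin.≟ v) ×-dec ((u , v) ∈?ᴸ L ⊎-dec (v , u) ∈?ᴸ L)
  ; sym    = λ (u≢v , uv) → u≢v ∘ sym , [ inj₂ , inj₁ ]′ uv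
  ; irrefl = λ (v≢v , _) → v≢v refl
  }
  where open DecMembership (≡-dec (Fin._≟_ {n}) Fin._≟_) using () renaming (_∈?_ to _∈?ᴸ_)

-- Only an inequality, since a list may contain loops, repetitions and both orientations of an edge.
-- After sorting each pair, the duplicate-free list of edges is contained in the result, and
-- pigeonhole applies.
size-fromList-≤ : (L : List (Fin n × Fin n)) → size (fromList L) ≤ length L
size-fromList-≤ {n} L = begin
  size (fromList L)       ≤⟨ unique-⊆⇒length-≤ (Unique.filter⁺ _ (Unique.cartesianProduct⁺ (Unique.allFin⁺ n) (Unique.allFin⁺ n))) sub ⟩
  length (map sorted L)   ≡⟨ length-map sorted L ⟩
  length L                ∎
  where
  open ≤-Reasoning
  sorted : Fin n × Fin n → Fin n × Fin n
  sorted (u , v) with u Fin.<? v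
  ... | yes _ = u , v
  ... | no _  = v , u
  sorted-< : ∀ {u v} → u Fin.< v → sorted (u , v) ≡ (u , v)
  sorted-< {u} {v} u<v with u Fin.<? v
  ... | yes _   = refl
  ... | no u≮v  = ⊥-elim (u≮v u<v)
  sorted-> : ∀ {u v} → u Fin.< v → sorted (v , u) ≡ (u , v)
  sorted-> {u} {v} u<v with v Fin.<? u
  ... | yes v<u = ⊥-elim (<-asym u<v v<u)
  ... | no _    = refl
  sub : ∀ {e} → e ∈ᴸ edges (fromList L) → e ∈ᴸ map sorted L
  sub {u , v} e∈ with proj₂ (∈-filter⁻ _ {xs = cartesianProduct (allFin n) (allFin n)} e∈)
  ... | u<v , _ , inj₁ uv∈L = subst (_∈ᴸ map sorted L) (sorted-< u<v) (∈-map⁺ sorted uv∈L)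
  ... | u<v , _ , inj₂ vu∈L = subst (_∈ᴸ map sorted L) (sorted-> u<v) (∈-map⁺ sorted vu∈L)

-- Circulant graphs

half-≤ : ∀ {m n} → m + m ≤ n + n → m ≤ n
half-≤ m+m≤n+n = ≮⇒≥ λ n<m → <⇒≱ (+-mono-< n<m n<m) m+m≤n+n

half-< : ∀ {m n} → m + m < n + n → m < n
half-< m+m<n+n = ≰⇒> λ n≤m → <⇒≱ m+m<n+n (+-mono-≤ n≤m n≤m)

-- Positions on the cycle are natural numbers, reduced mod p later, so that an arc passing vertex 0
-- is still an interval. With the indicator of a deleted set for `ρ`, a window counts the deleted
-- vertices on an arc.
window : (ℕ → ℕ) → ℕ → ℕ → ℕ
window ρ a zero    = 0
window ρ a (suc ℓ) = ρ a + window ρ (suc a) ℓ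

module _ (ρ : ℕ → ℕ) where

  window-+ : ∀ a m n → window ρ a (m + n) ≡ window ρ a m + window ρ (a + m) n
  window-+ a zero    n = cong (λ b → window ρ b n) (sym (+-identityʳ a))
  window-+ a (suc m) n = begin
    ρ a + window ρ (suc a) (m + n)                            ≡⟨ cong (ρ a +_) (window-+ (suc a) m n) ⟩
    ρ a + (window ρ (suc a) m + window ρ (suc a + m) n)       ≡⟨ +-assoc (ρ a) _ _ ⟨
    ρ a + window ρ (suc a) m + window ρ (suc a + m) n         ≡⟨ cong (λ b → ρ a + window ρ (suc a) m + window ρ b n) (+-suc a m) ⟨
    ρ a + window ρ (suc a) m + window ρ (a + suc m) n         ∎
    where open ≡-Reasoning

  window≡sum : ∀ a ℓ → window ρ a ℓ ≡ ∑[ i < ℓ ] ρ (a + toℕ i)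
  window≡sum a zero    = refl
  window≡sum a (suc ℓ) = cong₂ _+_ (cong ρ (sym (+-identityʳ a)))
    (trans (window≡sum (suc a) ℓ) (sum-cong-≗ {ℓ} λ i → cong ρ (sym (+-suc a (toℕ i)))))

  window≡0 : ∀ {a ℓ i} → window ρ a ℓ ≡ 0 → i < ℓ → ρ (a + i) ≡ 0
  window≡0 {a} {suc ℓ} {zero}  eq _         = trans (cong ρ (+-identityʳ a)) (m+n≡0⇒m≡0 (ρ a) eq)
  window≡0 {a} {suc ℓ} {suc i} eq (s≤s i<ℓ) =
    trans (cong ρ (+-suc a i)) (window≡0 (m+n≡0⇒n≡0 (ρ a) eq) i<ℓ)

  module _ {p} (periodic : ∀ n → ρ (n + p) ≡ ρ n) where

    window-periodic : ∀ a ℓ → window ρ (a + p) ℓ ≡ window ρ a ℓ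
    window-periodic a zero    = refl
    window-periodic a (suc ℓ) = cong₂ _+_ (periodic a) (window-periodic (suc a) ℓ)

    -- Moving the start by one position loses `ρ a` and gains `ρ (a + p)`, which are equal.
    window-period : ∀ a → window ρ a p ≡ window ρ 0 p
    window-period zero    = refl
    window-period (suc a) = trans (+-cancelˡ-≡ (ρ a) _ _ shift) (window-period a)
      where
      open ≡-Reasoning
      shift : ρ a + window ρ (suc a) p ≡ ρ a + window ρ a p
      shift = begin
        window ρ a (1 + p)              ≡⟨ cong (window ρ a) (+-comm 1 p) ⟩
        window ρ a (p + 1)              ≡⟨ window-+ a p 1 ⟩
        window ρ a p + (ρ (a + p) + 0)  ≡⟨ cong (window ρ a p +_) (trans (+-identityʳ _) (periodic a)) ⟩
        window ρ a p + ρ a              ≡⟨ +-comm _ (ρ a) ⟩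
        ρ a + window ρ a p              ∎

module _ {p : ℕ} .⦃ _ : NonZero p ⦄ where

  π : ℕ → Fin p
  π n = n mod p

  π-cong : ∀ {m n} → m % p ≡ n % p → π m ≡ π n
  π-cong {m} {n} eq = Fin.toℕ-injective
    (trans (Fin.toℕ-fromℕ< (m%n<n m p)) (trans eq (sym (Fin.toℕ-fromℕ< (m%n<n n p)))))

  π-periodic : ∀ n → π (n + p) ≡ π n
  π-periodic n = π-cong ([m+n]%n≡m%n n p)

  π-toℕ : ∀ i → π (toℕ i) ≡ i
  π-toℕ i = Fin.toℕ-injective (trans (Fin.toℕ-fromℕ< (m%n<n (toℕ i) p)) (m<n⇒m%n≡m (Fin.toℕ<n i)))

  module _ (G : Graph p) where
    open Graph G renaming (sym to Adj-sym)

    -- Positions may name the same vertex, because fromList drops loops.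
    Linked : ℕ → ℕ → Set
    Linked m n = π m ≡ π n ⊎ Adj (π m) (π n)

    module Deletion (S : Subset p) where

      ρ : ℕ → ℕ
      ρ n = bit (lookup S (π n))

      ρ-periodic : ∀ n → ρ (n + p) ≡ ρ n
      ρ-periodic n = cong (λ i → bit (lookup S i)) (π-periodic n)

      ∉⇒ρ≡0 : ∀ {n} → π n ∉ S → ρ n ≡ 0
      ∉⇒ρ≡0 {n} n∉S with lookup S (π n) in eq
      ... | true  = ⊥-elim (n∉S (lookup⇒[]= (π n) S eq))
      ... | false = refl

      ρ≡0⇒∉ : ∀ {n} → ρ n ≡ 0 → π n ∉ S
      ρ≡0⇒∉ ρ≡0 n∈S with trans (sym (cong bit ([]=⇒lookup n∈S))) ρ≡0
      ... | ()

      ∣S∣≡window : ∀ a → ∣ S ∣ ≡ window ρ a p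
      ∣S∣≡window a = begin
        ∣ S ∣                       ≡⟨ ∣ S ∣≡sum ⟩
        sum (λ i → bit (lookup S i)) ≡⟨ sum-cong-≗ (λ i → cong (λ j → bit (lookup S j)) (π-toℕ i)) ⟨
        sum (λ i → ρ (toℕ {p} i))   ≡⟨ window≡sum ρ 0 p ⟨
        window ρ 0 p                ≡⟨ window-period ρ ρ-periodic a ⟨
        window ρ a p                ∎
        where open ≡-Reasoning

      Reach : ℕ → ℕ → Set
      Reach m n = Star (AdjOutside G S) (π m) (π n)

      Star-sym : ∀ {u v} → Star (AdjOutside G S) u v → Star (AdjOutside G S) v u
      Star-sym = reverse λ (u∉S , v∉S , uv) → v∉S , u∉S , Adj-sym uv

      link : ∀ {m n} → ρ m ≡ 0 → ρ n ≡ 0 → Linked m n → Reach m n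
      link {m} ρm ρn (inj₁ eq) = subst (Star (AdjOutside G S) (π m)) eq ε
      link ρm ρn (inj₂ mn)     = (ρ≡0⇒∉ ρm , ρ≡0⇒∉ ρn , mn) ◅ ε

      module Steps (r : ℕ) (step : ∀ n t → t < r → Linked n (n + suc t)) where

        -- A block of r consecutive deleted positions, with x positions strictly between `a` and the
        -- block and y strictly between the block and `a + ℓ`.
        Gap : ℕ → ℕ → Set
        Gap a ℓ = ∃[ x ] ∃[ y ] ℓ ≡ suc x + (r + y) × window ρ (a + suc x) r ≡ r

        scan : ∀ a m → (∃[ t ] t < m × ρ (a + t) ≡ 0) ⊎ window ρ a m ≡ m
        scan a zero = inj₂ refl
        scan a (suc m) with lookup S (π a) in eq
        ... | false = inj₁ (0 , s≤s z≤n , trans (cong ρ (+-identityʳ a)) (cong bit eq))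
        ... | true with scan (suc a) m
        ...   | inj₁ (t , t<m , ρ≡0) = inj₁ (suc t , s≤s t<m , trans (cong ρ (+-suc a t)) ρ≡0)
        ...   | inj₂ full            = inj₂ (cong suc full)

        -- Greedy walk: from a surviving position jump to the target if it is within r steps,
        -- otherwise to a survivor among the next r positions. If there is none, those r positions
        -- form the gap. The argument `bound` makes the recursion structural, as a jump shortens ℓ
        -- by an arbitrary amount.
        arc : ∀ bound ℓ a → ℓ ≤ bound → ρ a ≡ 0 → ρ (a + ℓ) ≡ 0 → Reach a (a + ℓ) ⊎ Gap a ℓ
        arc _ zero a _ ρa ρℓ = inj₁ (subst (Reach a) (sym (+-identityʳ a)) ε)
        arc (suc bound) (suc ℓ) a (s≤s ℓ≤bound) ρa ρℓ with ℓ <? r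
        ... | yes ℓ<r = inj₁ (link ρa ρℓ (step a ℓ ℓ<r))
        ... | no ℓ≮r with scan (suc a) r
        ...   | inj₂ full = inj₂ (0 , ℓ ∸ r , cong suc (sym (m+[n∸m]≡n (≮⇒≥ ℓ≮r)))
                                  , subst (λ b → window ρ b r ≡ r) (+-comm 1 a) full)
        ...   | inj₁ (t , t<r , ρt) = continue (arc bound (ℓ ∸ t) (a + suc t)
                  (≤-trans (m∸n≤m ℓ t) ℓ≤bound) ρt′ (subst (λ b → ρ b ≡ 0) (sym end) ρℓ))
          where
          total : t + (ℓ ∸ t) ≡ ℓ
          total = m+[n∸m]≡n (≤-trans (<⇒≤ t<r) (≮⇒≥ ℓ≮r))
          end : a + suc t + (ℓ ∸ t) ≡ a + suc ℓ
          end = trans (+-assoc a (suc t) (ℓ ∸ t)) (cong (λ b → a + suc b) total)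
          ρt′ : ρ (a + suc t) ≡ 0
          ρt′ = trans (cong ρ (+-suc a t)) ρt
          continue : Reach (a + suc t) (a + suc t + (ℓ ∸ t)) ⊎ Gap (a + suc t) (ℓ ∸ t) →
                     Reach a (a + suc ℓ) ⊎ Gap a (suc ℓ)
          continue (inj₁ path) = inj₁ (link ρa ρt′ (step a t t<r) ◅◅ subst (Reach _) end path)
          continue (inj₂ (x , y , eq , full)) = inj₂ (suc t + x , y ,
            cong suc (trans (sym total) (trans (cong (t +_) eq) (rearrange t x (r + y)))) ,
            subst (λ b → window ρ b r ≡ r) (regroup a t x) full)
            where
            rearrange : ∀ t x z → t + (suc x + z) ≡ suc t + x + z
            rearrange = solve-∀
            regroup : ∀ a t x → a + suc t + suc x ≡ a + suc (suc t + x)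
            regroup = solve-∀

        -- Going round the cycle from position a: an arc of length A containing v, r deleted
        -- vertices, an arc of length B from b containing u, r deleted vertices. The
        -- two arcs may contain further deleted vertices.
        record TwoGaps (u v : ℕ) : Set where
          field
            a A B i j : ℕ
          b : ℕ
          b = a + A + r
          field
            period : A + r + B + r ≡ p
            i<A    : i < A
            j<B    : j < B
            u-pos  : π u ≡ π (b + j)
            v-pos  : π v ≡ π (a + i)
            total  : ∣ S ∣ ≡ (r + r) + (window ρ a A + window ρ b B)

        -- Try the arc from u forward to `u + ℓ`, then the complementary arc from there on to
        -- `u + p`, which is u again. If both walks fail, each arc contains a gap.
        dichotomy : ∀ u ℓ → ℓ ≤ p → ρ u ≡ 0 → ρ (u + ℓ) ≡ 0 → Reach u (u + ℓ) ⊎ TwoGaps u (u + ℓ)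
        dichotomy u ℓ ℓ≤p ρu ρv with arc ℓ ℓ u ≤-refl ρu ρv
        ... | inj₁ path = inj₁ path
        ... | inj₂ (x , y , ℓ≡ , full) = finish (arc ℓ′ ℓ′ (u + ℓ) ≤-refl ρv
                  (trans (cong ρ end) (trans (ρ-periodic u) ρu)))
          where
          ℓ′ : ℕ
          ℓ′ = p ∸ ℓ
          end : u + ℓ + ℓ′ ≡ u + p
          end = trans (+-assoc u ℓ ℓ′) (cong (u +_) (m+[n∸m]≡n ℓ≤p))
          finish : Reach (u + ℓ) (u + ℓ + ℓ′) ⊎ Gap (u + ℓ) ℓ′ → Reach u (u + ℓ) ⊎ TwoGaps u (u + ℓ)
          finish (inj₁ path) = inj₁ (Star-sym
            (subst (Star (AdjOutside G S) (π (u + ℓ))) (trans (cong π end) (π-periodic u)) path))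
          finish (inj₂ (x′ , y′ , ℓ′≡ , full′)) = inj₂ record
            { a = s + r ; A = A ; B = B ; i = y ; j = y′
            ; period = period
            ; i<A    = subst (_≤ A) (+-comm y 1) (+-monoʳ-≤ y (s≤s z≤n))
            ; j<B    = subst (_≤ B) (+-comm y′ 1) (+-monoʳ-≤ y′ (s≤s z≤n))
            ; u-pos  = trans (sym (π-periodic u)) (cong π
                (trans (sym end) (trans (cong₂ (λ m m′ → u + m + m′) ℓ≡ ℓ′≡) (eq₁ u x y x′ y′ r))))
            ; v-pos  = cong π (trans (cong (u +_) ℓ≡) (eq₂ u x y r))
            ; total  = total
            }
            where
            -- `s` is where the first gap starts. Between the gaps lie y positions, then v, then
            -- `x′` positions, giving `A` and the offset `i = y`. The other arc has `y′` positions,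
            -- then u one period later, then x positions, giving `B` and `j = y′`.
            s A B : ℕ
            s = u + suc x
            A = y + suc x′
            B = y′ + suc x
            eq₁ : ∀ u x y x′ y′ r → u + (suc x + (r + y)) + (suc x′ + (r + y′)) ≡
                                    u + suc x + r + (y + suc x′) + r + y′
            eq₁ = solve-∀
            eq₂ : ∀ u x y r → u + (suc x + (r + y)) ≡ u + suc x + r + y
            eq₂ = solve-∀
            eq₃ : ∀ x y x′ y′ r → y + suc x′ + r + (y′ + suc x) + r ≡
                                  (suc x + (r + y)) + (suc x′ + (r + y′))
            eq₃ = solve-∀
            eq₄ : ∀ u x y x′ r → u + (suc x + (r + y)) + suc x′ ≡ u + suc x + r + (y + suc x′)
            eq₄ = solve-∀
            eq₅ : ∀ r A B → A + r + B + r ≡ r + (A + (r + B))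
            eq₅ = solve-∀
            eq₆ : ∀ r m n → r + (m + (r + n)) ≡ r + r + (m + n)
            eq₆ = solve-∀
            period : A + r + B + r ≡ p
            period = trans (eq₃ x y x′ y′ r) (trans (sym (cong₂ _+_ ℓ≡ ℓ′≡)) (m+[n∸m]≡n ℓ≤p))
            second : window ρ (s + r + A) r ≡ r
            second = subst (λ c → window ρ c r ≡ r)
              (trans (cong (λ m → u + m + suc x′) ℓ≡) (eq₄ u x y x′ r)) full′
            open ≡-Reasoning
            -- Count the deleted vertices over one full period from `s`, in the order gap, A, gap,
            -- B.
            total : ∣ S ∣ ≡ (r + r) + (window ρ (s + r) A + window ρ (s + r + A + r) B)
            total = begin
              ∣ S ∣ ≡⟨ ∣S∣≡window s ⟩
              window ρ s p ≡⟨ cong (window ρ s) (trans (sym period) (eq₅ r A B)) ⟩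
              window ρ s (r + (A + (r + B)))
                ≡⟨ window-+ ρ s r _ ⟩
              window ρ s r + window ρ (s + r) (A + (r + B))
                ≡⟨ cong₂ _+_ full (window-+ ρ (s + r) A _) ⟩
              r + (window ρ (s + r) A + window ρ (s + r + A) (r + B))
                ≡⟨ cong (λ w → r + (window ρ (s + r) A + w)) (trans (window-+ ρ (s + r + A) r B) (cong (_+ window ρ (s + r + A + r) B) second)) ⟩
              r + (window ρ (s + r) A + (r + window ρ (s + r + A + r) B))
                ≡⟨ eq₆ r (window ρ (s + r) A) (window ρ (s + r + A + r) B) ⟩
              _ ∎

        -- Isolates where the bound on ∣ S ∣ enters: for even connectivity two gaps are
        -- contradictory, for odd connectivity a chord crosses them.
        connected-if : (∀ {u v} → TwoGaps u v → Reach u v) → ConnectedOutside G S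
        connected-if bridge u v u∉S v∉S =
          [ (λ u≤v → ordered u≤v u∉S v∉S) , (λ v≤u → Star-sym (ordered v≤u v∉S u∉S)) ]′ (≤-total (toℕ u) (toℕ v))
          where
          ordered : ∀ {u v} → toℕ u ≤ toℕ v → u ∉ S → v ∉ S → Star (AdjOutside G S) u v
          ordered {u} {v} u≤v u∉S v∉S = subst₂ (Star (AdjOutside G S)) (π-toℕ u) end
            ([ (λ path → path) , bridge ]′
              (dichotomy (toℕ u) (toℕ v ∸ toℕ u) (≤-trans (m∸n≤m (toℕ v) (toℕ u)) (<⇒≤ (Fin.toℕ<n v)))
                (∉⇒ρ≡0 (u∉S ∘ subst (_∈ S) (π-toℕ u)))
                (∉⇒ρ≡0 (v∉S ∘ subst (_∈ S) end))))
            where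
            end : π (toℕ u + (toℕ v ∸ toℕ u)) ≡ v
            end = trans (cong π (m+[n∸m]≡n u≤v)) (π-toℕ v)

        connected-even : ∣ S ∣ < r + r → ConnectedOutside G S
        connected-even ∣S∣< = connected-if λ gaps →
          ⊥-elim (<⇒≱ ∣S∣< (≤-trans (m≤m+n (r + r) _) (≤-reflexive (sym (TwoGaps.total gaps)))))

        -- Chords have step h, about half of p, but a vertex may be only the far end of one.
        -- Followed backwards, such a chord advances by p - h, which is `h` or `suc h` when p is 2h
        -- or 2h + 1; hence the two alternatives.
        module Chords (0<r : 0 < r) (h : ℕ) (r<h : r < h) (2h≤p : h + h ≤ p)
          (chord : ∀ n → Linked n (n + h) ⊎ (h + h < p × Linked n (n + suc h))) where

          walk : ∀ a j → (∀ i → i ≤ j → ρ (a + i) ≡ 0) → Reach a (a + j)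
          walk a zero    clean = subst (Reach a) (sym (+-identityʳ a)) ε
          walk a (suc j) clean = walk a j (λ i i≤j → clean i (m≤n⇒m≤1+n i≤j)) ◅◅
            subst (Reach (a + j)) next
              (link (clean j (n≤1+n j)) (trans (cong ρ next) (clean (suc j) ≤-refl)) (step (a + j) 0 0<r))
            where
            next : a + j + 1 ≡ a + suc j
            next = trans (+-assoc a j 1) (cong (a +_) (+-comm j 1))

          clean-reach : ∀ {a ℓ i j} → window ρ a ℓ ≡ 0 → i < ℓ → j < ℓ → Reach (a + i) (a + j)
          clean-reach {a} {ℓ} clean i<ℓ j<ℓ = Star-sym (from i<ℓ) ◅◅ from j<ℓ
            where
            from : ∀ {i} → i < ℓ → Reach a (a + i)
            from {i} i<ℓ = walk a i λ m m≤i → window≡0 ρ clean (≤-<-trans m≤i i<ℓ)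

          -- Take the chord at the last position of the shorter arc. It jumps past the r deleted
          -- positions, because r < h, and lands at offset h - (r + 1) of the other arc, or one
          -- further. This is within that arc because p ≤ 2(B + r), so h ≤ B + r, and h < B + r if
          -- 2h < p. Keeping `b` as a variable with an equation lets the arcs be exchanged.
          cross : ∀ {a b A B i j} → b ≡ a + A + r → A + r + B + r ≡ p → A ≤ B →
            window ρ a A ≡ 0 → window ρ b B ≡ 0 → i < A → j < B → Reach (a + i) (b + j)
          cross {a} {A = suc A} {B} refl period A≤B cleanA cleanB i<A j<B =
            clean-reach cleanA i<A ≤-refl ◅◅ proj₂ (proj₂ bridge) ◅◅ clean-reach cleanB (proj₁ (proj₂ bridge)) j<B
            where
            b t : ℕ
            b = a + suc A + r
            t = h ∸ suc r
            h≡ : suc r + t ≡ h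
            h≡ = m+[n∸m]≡n r<h
            p≤ : p ≤ (B + r) + (B + r)
            p≤ = subst (_≤ (B + r) + (B + r)) (trans (eq (suc A) B r) period)
              (+-monoˡ-≤ (B + r) (+-monoˡ-≤ r A≤B))
              where
              eq : ∀ A B r → A + r + (B + r) ≡ A + r + B + r
              eq = solve-∀
            target : ∀ a A r t → a + suc A + r + t ≡ a + A + (suc r + t)
            target = solve-∀
            land : a + A + h ≡ b + t
            land = trans (cong (a + A +_) (sym h≡)) (sym (target a A r t))
            land′ : a + A + suc h ≡ b + suc t
            land′ = trans (+-suc (a + A) h) (trans (cong suc land) (sym (+-suc b t)))
            ρ-end : ρ (a + A) ≡ 0
            ρ-end = window≡0 ρ cleanA ≤-refl
            arrive : ∀ {n t} → n ≡ b + t → t < B → Linked (a + A) n → ∃[ t ] t < B × Reach (a + A) (b + t)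
            arrive {t = t} refl t<B linked = t , t<B , link ρ-end (window≡0 ρ cleanB t<B) linked
            shrink : ∀ {m} → suc r + m ≤ B + r → m < B
            shrink {m} le = +-cancelʳ-≤ r (suc m) B (subst (_≤ B + r) (eq r m) le)
              where
              eq : ∀ r m → suc r + m ≡ suc m + r
              eq = solve-∀
            bridge : ∃[ t ] t < B × Reach (a + A) (b + t)
            bridge with chord (a + A)
            ... | inj₁ linked = arrive land
              (shrink (subst (_≤ B + r) (sym h≡) (half-≤ (≤-trans 2h≤p p≤)))) linked
            ... | inj₂ (2h<p , linked) = arrive land′
              (shrink (subst (_≤ B + r) (trans (cong suc (sym h≡)) (sym (+-suc (suc r) t))) (half-< (<-≤-trans 2h<p p≤)))) linked

          connected-odd : ∣ S ∣ ≤ r + r → ConnectedOutside G S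
          connected-odd ∣S∣≤ = connected-if bridge
            where
            bridge : ∀ {u v} → TwoGaps u v → Reach u v
            bridge {u} {v} gaps = subst₂ (Star (AdjOutside G S)) (sym u-pos) (sym v-pos) path
              where
              open TwoGaps gaps
              -- The two gaps already account for 2r deleted vertices, so none is left for the arcs.
              clean : window ρ a A + window ρ b B ≡ 0
              clean = n≤0⇒n≡0 (+-cancelˡ-≤ (r + r) _ _
                (≤-trans (≤-reflexive (sym total)) (≤-trans ∣S∣≤ (≤-reflexive (sym (+-identityʳ _))))))
              cleanA : window ρ a A ≡ 0
              cleanA = m+n≡0⇒m≡0 _ clean
              cleanB : window ρ b B ≡ 0
              cleanB = m+n≡0⇒n≡0 (window ρ a A) clean
              path : Reach (b + j) (a + i)
              path with ≤-total A B
              ... | inj₁ A≤B = Star-sym (cross refl period A≤B cleanA cleanB i<A j<B)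
              -- With the arcs exchanged, the one following B is A a period later, starting at
              -- `a + p`.
              ... | inj₂ B≤A = subst (Star (AdjOutside G S) (π (b + j)))
                (trans (cong π (eq₁ a p i)) (π-periodic (a + i)))
                (cross (trans (cong (a +_) (sym period)) (eq₂ a A B r)) (trans (eq₃ A B r) period) B≤A cleanB
                  (trans (window-periodic ρ ρ-periodic a A) cleanA) j<B i<A)
                where
                eq₁ : ∀ a p i → a + p + i ≡ a + i + p
                eq₁ = solve-∀
                eq₂ : ∀ a A B r → a + (A + r + B + r) ≡ a + A + r + B + r
                eq₂ = solve-∀
                eq₃ : ∀ A B r → B + r + A + r ≡ A + r + B + r
                eq₃ = solve-∀

-- Graphs with few edges

length-cartesianProductWith : ∀ {A B C : Set} (f : A → B → C) xs ys →
  length (cartesianProductWith f xs ys) ≡ length xs * length ys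
length-cartesianProductWith f []       ys = refl
length-cartesianProductWith f (x ∷ xs) ys = trans (length-++ (map (f x) ys))
  (cong₂ _+_ (length-map (f x) ys) (length-cartesianProductWith f xs ys))

length-allFin : ∀ n → length (allFin n) ≡ n
length-allFin n = length-tabulate {n = n} (λ i → i)

⌈m+m+n/2⌉ : ∀ m n → ⌈ m + m + n /2⌉ ≡ m + ⌈ n /2⌉
⌈m+m+n/2⌉ zero    n = refl
⌈m+m+n/2⌉ (suc m) n rewrite +-suc m m = cong suc (⌈m+m+n/2⌉ m n)

even⊎odd : ∀ n → n ≡ ⌊ n /2⌋ + ⌊ n /2⌋ ⊎ n ≡ suc (⌊ n /2⌋ + ⌊ n /2⌋)
even⊎odd zero          = inj₁ refl
even⊎odd (suc zero)    = inj₂ refl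
even⊎odd (suc (suc n)) = Sum.map (λ eq → cong suc (trans (cong suc eq) (sym (+-suc _ _))))
                               (λ eq → cong suc (cong suc (trans eq (sym (+-suc _ _))))) (even⊎odd n)

∈⇒0<∣_∣ : ∀ (S : Subset n) {v} → v ∈ S → 0 < ∣ S ∣
∈⇒0<∣ S ∣ v∈S = m<n⇒0<n (x∈p⇒∣p-x∣<∣p∣ v∈S)

∣_∣<n⇒∃∉ : ∀ (S : Subset n) → ∣ S ∣ < n → ∃[ v ] v ∉ S
∣_∣<n⇒∃∉ {n} S ∣S∣<n with Fin.any? (λ v → ¬? (v ∈? S))
... | yes found = found
... | no none   = ⊥-elim (<⇒≱ ∣S∣<n (subst (_≤ ∣ S ∣) (∣⊤∣≡n n) (p⊆q⇒∣p∣≤∣q∣ full)))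
  where
  full : ⊤ ⊆ S
  full {v} _ with v ∈? S
  ... | yes v∈S = v∈S
  ... | no v∉S  = ⊥-elim (none (v , v∉S))

-- The value of m(p, d) for d + 2 ≤ p. The case d = 1 is separate because connectedness forces p - 1
-- edges, more than the degree bound ⌈p/2⌉ when p ≥ 3.
edgeNumber : ℕ → ℕ → ℕ
edgeNumber p 0             = 0
edgeNumber p 1             = p ∸ 1
edgeNumber p d@(suc (suc _)) = ⌈ p * d /2⌉

edgeNumber-≤ : ∀ {p} d (G : Graph p) → Connected₀ d G → edgeNumber p d ≤ size G
edgeNumber-≤ 0             G conn = z≤n
edgeNumber-≤ 1             G conn = connected⇒n∸1≤size G conn
edgeNumber-≤ (suc (suc d)) G conn = ⌈nk/2⌉≤size G conn

record Sparse (p d : ℕ) : Set where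
  constructor sparse
  field
    edgeList  : List (Fin p × Fin p)
    connected : Connected₀ d (fromList edgeList)
    few       : length edgeList ≤ edgeNumber p d

star : ∀ p → 1 < p → Sparse p 1
star (suc p) 1<p = sparse L (1<p , conn)
  (≤-reflexive (trans (length-map _ (allFin p)) (length-allFin p)))
  where
  L : List (Fin (suc p) × Fin (suc p))
  L = map (λ i → zero , suc i) (allFin p)
  conn : ∀ S → ∣ S ∣ < 1 → ConnectedOutside (fromList L) S
  conn S (s≤s ∣S∣≤0) u v _ _ = reverse (λ (u∉S , v∉S , uv) → v∉S , u∉S , Graph.sym (fromList L) uv) (centre u) ◅◅ centre v
    where
    none : ∀ w → w ∉ S
    none w w∈S = <⇒≱ (∈⇒0<∣ S ∣ w∈S) ∣S∣≤0
    centre : ∀ w → Star (AdjOutside (fromList L) S) zero w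
    centre zero    = ε
    centre (suc i) = (none zero , none (suc i) , (λ ()) , inj₁ (∈-map⁺ _ (∈-allFin i))) ◅ ε

module _ {p : ℕ} .⦃ _ : NonZero p ⦄ where

  π-+ : ∀ n m → π {p} (toℕ (π {p} n) + m) ≡ π (n + m)
  π-+ n m = π-cong (begin
    (toℕ (π {p} n) + m) % p          ≡⟨ cong (λ x → (x + m) % p) (Fin.toℕ-fromℕ< (m%n<n n p)) ⟩
    (n % p + m) % p                  ≡⟨ %-distribˡ-+ (n % p) m p ⟩
    (n % p % p + m % p) % p          ≡⟨ cong (λ x → (x + m % p) % p) (m%n%n≡m%n n p) ⟩
    (n % p + m % p) % p              ≡⟨ %-distribˡ-+ n m p ⟨
    (n + m) % p                      ∎)
    where open ≡-Reasoning

  linked : ∀ L m n → (π m , π n) ∈ᴸ L ⊎ (π n , π m) ∈ᴸ L → Linked (fromList L) m n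
  linked L m n listed with π {p} m Fin.≟ π n
  ... | yes eq = inj₁ eq
  ... | no neq = inj₂ (neq , listed)

  circulant : ℕ → List (Fin p × Fin p)
  circulant r = cartesianProductWith (λ i t → i , π (toℕ i + suc (toℕ t))) (allFin p) (allFin r)

  length-circulant : ∀ r → length (circulant r) ≡ p * r
  length-circulant r = trans (length-cartesianProductWith _ (allFin p) (allFin r))
    (cong₂ _*_ (length-allFin p) (length-allFin r))

  ∈-circulant : ∀ {r} n t → t < r → (π n , π (n + suc t)) ∈ᴸ circulant r
  ∈-circulant {r} n t t<r = subst (λ v → (π n , v) ∈ᴸ circulant r)
    (trans (cong (λ s → π (toℕ (π {p} n) + suc s)) (Fin.toℕ-fromℕ< t<r)) (π-+ n (suc t)))
    (∈-cartesianProductWith⁺ _ (∈-allFin (π n)) (∈-allFin (fromℕ< t<r)))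

  -- Starting points stop before p - h, so that for h = ⌊p/2⌋ there are exactly ⌈p/2⌉ chords, and
  -- still every vertex is an end of one.
  chords : ℕ → List (Fin p × Fin p)
  chords h = map (λ i → π (toℕ i) , π (toℕ i + h)) (allFin (p ∸ h))

  length-chords : ∀ h → length (chords h) ≡ p ∸ h
  length-chords h = trans (length-map _ (allFin (p ∸ h))) (length-allFin (p ∸ h))

  ∈-chords : ∀ {h m} → m < p ∸ h → (π m , π (m + h)) ∈ᴸ chords h
  ∈-chords {h} {m} m< = subst (λ m → (π m , π (m + h)) ∈ᴸ chords h) (Fin.toℕ-fromℕ< m<)
    (∈-map⁺ _ (∈-allFin (fromℕ< m<)))

  -- Let m be n reduced mod p. If m < p - h, a chord starts there. Otherwise m ≥ h and the chord
  -- from j = m - h ends there; going forward, j is p - h positions after m.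
  chord : ∀ {h} L → (∀ {e} → e ∈ᴸ chords h → e ∈ᴸ L) → p ≡ h + h ⊎ p ≡ suc (h + h) → ∀ n →
    Linked (fromList L) n (n + h) ⊎ (h + h < p × Linked (fromList L) n (n + suc h))
  chord {h} L chords⊆L p≡ n with toℕ (π {p} n) <? p ∸ h
  ... | yes m< = inj₁ (linked L n (n + h) (inj₁
    (subst₂ (λ u v → (u , v) ∈ᴸ L) (π-toℕ (π n)) (π-+ n h) (chords⊆L (∈-chords m<)))))
  ... | no m≮ = back p≡
    where
    m j : ℕ
    m = toℕ (π {p} n)
    j = m ∸ h
    h≤p∸h : h ≤ p ∸ h
    h≤p∸h = m+n≤o⇒m≤o∸n h ([ (λ eq → ≤-reflexive (sym eq)) , (λ eq → ≤-trans (n≤1+n _) (≤-reflexive (sym eq))) ]′ p≡)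
    j+h≡m : j + h ≡ m
    j+h≡m = m∸n+n≡m (≤-trans h≤p∸h (≮⇒≥ m≮))
    listed : (π j , π n) ∈ᴸ L
    listed = subst (λ v → (π j , v) ∈ᴸ L) (trans (cong π j+h≡m) (π-toℕ (π n)))
      (chords⊆L (∈-chords (∸-monoˡ-< (Fin.toℕ<n (π n)) (≤-trans h≤p∸h (≮⇒≥ m≮)))))
    wrap : ∀ g → p ≡ h + g → π j ≡ π (n + g)
    wrap g eq = begin
      π j            ≡⟨ π-periodic j ⟨
      π (j + p)      ≡⟨ cong (λ q → π (j + q)) eq ⟩
      π (j + (h + g)) ≡⟨ cong π (+-assoc j h g) ⟨
      π (j + h + g)  ≡⟨ cong (λ m → π (m + g)) j+h≡m ⟩
      π (m + g)      ≡⟨ π-+ n g ⟩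
      π (n + g)      ∎
      where open ≡-Reasoning
    back : p ≡ h + h ⊎ p ≡ suc (h + h) → _
    back (inj₁ eq) = inj₁ (linked L n (n + h) (inj₂ (subst (λ u → (u , π n) ∈ᴸ L) (wrap h eq) listed)))
    back (inj₂ eq) = inj₂ (≤-reflexive (sym eq) ,
      linked L n (n + suc h) (inj₂ (subst (λ u → (u , π n) ∈ᴸ L) (wrap (suc h) (trans eq (sym (+-suc h h)))) listed)))

  -- These are Harary graphs: p·r circulant edges suffice for connectivity 2r, and ⌈p/2⌉ chords
  -- raise it to 2r + 1.
  harary : ∀ d → 4 + d ≤ p → Sparse p (2 + d)
  harary d 4+d≤p = cases (even⊎odd (2 + d))
    where
    r h : ℕ
    r = ⌊ 2 + d /2⌋
    h = ⌊ p /2⌋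
    large : 2 + d < p
    large = ≤-trans (n≤1+n _) 4+d≤p
    module _ (L : List (Fin p × Fin p)) (circulant⊆L : ∀ {e} → e ∈ᴸ circulant r → e ∈ᴸ L) where
      step : ∀ n t → t < r → Linked (fromList L) n (n + suc t)
      step n t t<r = linked L n (n + suc t) (inj₁ (circulant⊆L (∈-circulant n t t<r)))
    cases : 2 + d ≡ r + r ⊎ 2 + d ≡ suc (r + r) → Sparse p (2 + d)
    cases (inj₁ even) = sparse L
      (large , λ S ∣S∣< → Deletion.Steps.connected-even (fromList L) S r (step L λ e → e) (subst (∣ S ∣ <_) even ∣S∣<))
      (≤-reflexive (begin
        length (circulant r)   ≡⟨ length-circulant r ⟩
        p * r                  ≡⟨ n≡⌈n+n/2⌉ (p * r) ⟩
        ⌈ p * r + p * r /2⌉    ≡⟨ cong ⌈_/2⌉ (*-distribˡ-+ p r r) ⟨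
        ⌈ p * (r + r) /2⌉      ≡⟨ cong (λ d → ⌈ p * d /2⌉) even ⟨
        ⌈ p * (2 + d) /2⌉      ∎))
      where
      open ≡-Reasoning
      L = circulant r
    cases (inj₂ odd) = sparse L
      (large , λ S ∣S∣< → Deletion.Steps.Chords.connected-odd (fromList L) S r (step L ∈-++⁺ˡ)
        (s≤s z≤n) h r<h 2h≤p (chord L (∈-++⁺ʳ (circulant r)) (even⊎odd p)) (s≤s⁻¹ (subst (∣ S ∣ <_) odd ∣S∣<)))
      (≤-reflexive (begin
        length (circulant r ++ᴸ chords h)              ≡⟨ length-++ (circulant r) ⟩
        length (circulant r) + length (chords h)      ≡⟨ cong₂ _+_ (length-circulant r) (length-chords h) ⟩
        p * r + (p ∸ h)                               ≡⟨ cong (λ q → p * r + (q ∸ h)) (⌊n/2⌋+⌈n/2⌉≡n p) ⟨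
        p * r + (h + ⌈ p /2⌉ ∸ h)                     ≡⟨ cong (p * r +_) (m+n∸m≡n h ⌈ p /2⌉) ⟩
        p * r + ⌈ p /2⌉                               ≡⟨ ⌈m+m+n/2⌉ (p * r) p ⟨
        ⌈ p * r + p * r + p /2⌉                       ≡⟨ cong ⌈_/2⌉ (expand p r) ⟨
        ⌈ p * suc (r + r) /2⌉                         ≡⟨ cong (λ d → ⌈ p * d /2⌉) odd ⟨
        ⌈ p * (2 + d) /2⌉                             ∎))
      where
      open ≡-Reasoning
      L = circulant r ++ᴸ chords h
      expand : ∀ p r → p * suc (r + r) ≡ p * r + p * r + p
      expand = solve-∀
      2h≤p : h + h ≤ p
      2h≤p = ≤-trans (+-monoʳ-≤ h (⌊n/2⌋≤⌈n/2⌉ p)) (≤-reflexive (⌊n/2⌋+⌈n/2⌉≡n p))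
      p≤1+2h : p ≤ suc (h + h)
      p≤1+2h = [ (λ eq → ≤-trans (≤-reflexive eq) (n≤1+n _)) , ≤-reflexive ]′ (even⊎odd p)
      -- Since 2 + d = 2r + 1, the hypothesis on p says 2r + 3 ≤ p ≤ 2h + 1.
      r<h : r < h
      r<h = half-≤ (s≤s⁻¹ (≤-trans (≤-reflexive (trans (cong (λ n → 2 + n) (+-suc r r)) (cong (λ d → 2 + d) (sym odd))))
                                   (≤-trans 4+d≤p p≤1+2h)))

sparse-graph : ∀ p d → 2 + d ≤ p → Sparse p d
sparse-graph p             0             _     = sparse [] tt z≤n
sparse-graph p             1             3≤p   = star p (≤-trans (n≤1+n 2) 3≤p)
sparse-graph p@(suc _)     (suc (suc d)) 4+d≤p = harary d 4+d≤p

-- Joins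

∣++∣ : ∀ {m n} (S : Subset m) (T : Subset n) → ∣ S ++ T ∣ ≡ ∣ S ∣ + ∣ T ∣
∣++∣ []            T = refl
∣++∣ (inside  ∷ S) T = cong suc (∣++∣ S T)
∣++∣ (outside ∷ S) T = ∣++∣ S T

module _ {m n} (S : Subset m) (T : Subset n) where

  ↑ˡ∈++⁺ : ∀ {i} → i ∈ S → i ↑ˡ n ∈ S ++ T
  ↑ˡ∈++⁺ {i} i∈S = lookup⇒[]= (i ↑ˡ n) (S ++ T) (trans (lookup-++ˡ S T i) ([]=⇒lookup i∈S))

  ↑ˡ∈++⁻ : ∀ {i} → i ↑ˡ n ∈ S ++ T → i ∈ S
  ↑ˡ∈++⁻ {i} i∈ = lookup⇒[]= i S (trans (sym (lookup-++ˡ S T i)) ([]=⇒lookup i∈))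

  ↑ʳ∈++⁺ : ∀ {j} → j ∈ T → m ↑ʳ j ∈ S ++ T
  ↑ʳ∈++⁺ {j} j∈T = lookup⇒[]= (m ↑ʳ j) (S ++ T) (trans (lookup-++ʳ S T j) ([]=⇒lookup j∈T))

  ↑ʳ∈++⁻ : ∀ {j} → m ↑ʳ j ∈ S ++ T → j ∈ T
  ↑ʳ∈++⁻ {j} j∈ = lookup⇒[]= j T (trans (sym (lookup-++ʳ S T j)) ([]=⇒lookup j∈))

data View m n : Fin (m + n) → Set where
  left  : ∀ i → View m n (i ↑ˡ n)
  right : ∀ j → View m n (m ↑ʳ j)

view : ∀ m n x → View m n x
view m n x with splitAt m x in eq
... | inj₁ i = subst (View m n) (Fin.splitAt⁻¹-↑ˡ eq) (left i)
... | inj₂ j = subst (View m n) (Fin.splitAt⁻¹-↑ʳ eq) (right j)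

↑ˡ≢↑ʳ : ∀ {m n} {i : Fin m} {j : Fin n} → i ↑ˡ n ≢ m ↑ʳ j
↑ˡ≢↑ʳ {m} {n} {i} {j} eq with trans (sym (Fin.splitAt-↑ˡ m i n)) (trans (cong (splitAt m) eq) (Fin.splitAt-↑ʳ m n j))
... | ()

module Join (α k : ℕ) (L : List (Fin k × Fin k)) where

  cross : List (Fin (α + k) × Fin (α + k))
  cross = cartesianProductWith (λ i j → i ↑ˡ k , α ↑ʳ j) (allFin α) (allFin k)

  joined : List (Fin (α + k) × Fin (α + k))
  joined = cross ++ᴸ map (Product.map (α ↑ʳ_) (α ↑ʳ_)) L

  length-joined : length joined ≡ α * k + length L
  length-joined = trans (length-++ cross) (cong₂ _+_
    (trans (length-cartesianProductWith _ (allFin α) (allFin k)) (cong₂ _*_ (length-allFin α) (length-allFin k)))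
    (length-map _ L))

  G : Graph (α + k)
  G = fromList joined

  open Graph G renaming (sym to Adj-sym)

  cross-adj : ∀ i j → Adj (i ↑ˡ k) (α ↑ʳ j)
  cross-adj i j = ↑ˡ≢↑ʳ , inj₁ (∈-++⁺ˡ (∈-cartesianProductWith⁺ _ (∈-allFin i) (∈-allFin j)))

  right-adj : ∀ {u v} → Graph.Adj (fromList L) u v → Adj (α ↑ʳ u) (α ↑ʳ v)
  right-adj (u≢v , uv) = u≢v ∘ Fin.↑ʳ-injective α _ _ , Sum.map lift lift uv
    where
    lift : ∀ {e} → e ∈ᴸ L → Product.map (α ↑ʳ_) (α ↑ʳ_) e ∈ᴸ joined
    lift e∈L = ∈-++⁺ʳ cross (∈-map⁺ _ e∈L)

  left-independent : ∀ {u v : Fin α} → ¬ ((u ↑ˡ k , v ↑ˡ k) ∈ᴸ joined)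
  left-independent uv∈ with ∈-++⁻ cross uv∈
  ... | inj₁ uv∈cross with ∈-cartesianProductWith⁻ _ (allFin α) (allFin k) uv∈cross
  ...   | _ , _ , _ , _ , eq = ↑ˡ≢↑ʳ (cong proj₂ eq)
  left-independent uv∈ | inj₂ uv∈right with ∈-map⁻ _ uv∈right
  ...   | _ , _ , eq = ↑ˡ≢↑ʳ (cong proj₁ eq)

  independence-≥ : ∃[ S ] Independent G S × ∣ S ∣ ≡ α
  independence-≥ = ⊤ {α} ++ ⊥ {k} , indep ,
    trans (∣++∣ (⊤ {α}) (⊥ {k})) (trans (cong₂ _+_ (∣⊤∣≡n α) (∣⊥∣≡0 k)) (+-identityʳ α))
    where
    indep : Independent G (⊤ {α} ++ ⊥ {k})
    indep {u} {v} u∈ v∈ uv with view α k u | view α k v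
    ... | right _ | _       = ∉⊥ (↑ʳ∈++⁻ (⊤ {α}) ⊥ u∈)
    ... | left _  | right _ = ∉⊥ (↑ʳ∈++⁻ (⊤ {α}) ⊥ v∈)
    ... | left _  | left _  = [ left-independent , left-independent ]′ (proj₂ uv)

  module _ (S : Subset α) (T : Subset k) where

    private
      Path : Fin (α + k) → Fin (α + k) → Set
      Path = Star (AdjOutside G (S ++ T))

      Path-sym : ∀ {u v} → Path u v → Path v u
      Path-sym = reverse λ (u∉S , v∉S , uv) → v∉S , u∉S , Adj-sym uv

      edge : ∀ {i j} → i ∉ S → j ∉ T → Path (i ↑ˡ k) (α ↑ʳ j)
      edge {i} {j} i∉S j∉T = (i∉S ∘ ↑ˡ∈++⁻ S T , j∉T ∘ ↑ʳ∈++⁻ S T , cross-adj i j) ◅ ε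

    -- The surviving left vertex `i` is a hub: it sees every surviving right vertex, and reaches the
    -- left ones through `j`.
    left-survives : ∀ {i j} → i ∉ S → j ∉ T → ConnectedOutside G (S ++ T)
    left-survives {i} {j} i∉S j∉T u v u∉ v∉ = Path-sym (hub u u∉) ◅◅ hub v v∉
      where
      hub : ∀ w → w ∉ S ++ T → Path (i ↑ˡ k) w
      hub w w∉ with view α k w
      ... | right _ = edge i∉S (w∉ ∘ ↑ʳ∈++⁺ S T)
      ... | left _  = edge i∉S j∉T ◅◅ Path-sym (edge (w∉ ∘ ↑ˡ∈++⁺ S T) j∉T)

    left-deleted : (∀ i → i ∈ S) → ConnectedOutside (fromList L) T → ConnectedOutside G (S ++ T)
    left-deleted all conn u v u∉ v∉ with view α k u | view α k v
    ... | left i  | _       = ⊥-elim (u∉ (↑ˡ∈++⁺ S T (all i)))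
    ... | right _ | left i  = ⊥-elim (v∉ (↑ˡ∈++⁺ S T (all i)))
    ... | right u | right v = gmap (α ↑ʳ_)
      (λ (x∉ , y∉ , xy) → x∉ ∘ ↑ʳ∈++⁻ S T , y∉ ∘ ↑ʳ∈++⁻ S T , right-adj xy)
      (conn u v (u∉ ∘ ↑ʳ∈++⁺ S T) (v∉ ∘ ↑ʳ∈++⁺ S T))

-- For d = 0 no set has fewer than d elements, so the convention agrees with the deletion condition.
connected₀⇒connectedOutside : ∀ {p} d (G : Graph p) → Connected₀ d G →
  ∀ S → ∣ S ∣ < d → ConnectedOutside G S
connected₀⇒connectedOutside (suc d) G (_ , conn) = conn

-- Split the deleted set into its left part S and right part T. If a left vertex survives, so does a
-- right one, as ∣ T ∣ < α + d. If all α left vertices are deleted, fewer than d deletions remain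
-- for the right side.
join-connected : ∀ α d → 0 < α → (L : List (Fin (α + d) × Fin (α + d))) → Connected₀ d (fromList L) →
  Connected[_] (Join.G α (α + d) L) (α + d)
join-connected α d 0<α L conn = +-monoˡ-≤ (α + d) 0<α , outside-connected
  where
  open Join α (α + d) L
  outside-connected : ∀ U → ∣ U ∣ < α + d → ConnectedOutside G U
  outside-connected U ∣U∣< with Vec.splitAt α U
  ... | S , T , refl with Fin.any? (λ i → ¬? (i ∈? S))
  ...   | yes (i , i∉S) = left-survives S T i∉S (proj₂ (∣ T ∣<n⇒∃∉
      (≤-<-trans (≤-trans (m≤n+m ∣ T ∣ ∣ S ∣) (≤-reflexive (sym (∣++∣ S T)))) ∣U∣<)))
  ...   | no none = left-deleted S T all (connected₀⇒connectedOutside d (fromList L) conn T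
      (+-cancelˡ-< α ∣ T ∣ d (≤-<-trans (+-monoˡ-≤ ∣ T ∣ α≤∣S∣) (subst (_< α + d) (∣++∣ S T) ∣U∣<))))
    where
    all : ∀ i → i ∈ S
    all i with i ∈? S
    ... | yes i∈S = i∈S
    ... | no i∉S  = ⊥-elim (none (i , i∉S))
    α≤∣S∣ : α ≤ ∣ S ∣
    α≤∣S∣ = subst (_≤ ∣ S ∣) (∣⊤∣≡n α) (p⊆q⇒∣p∣≤∣q∣ {p = ⊤} λ {i} _ → all i)

-- The values of f and m

⌈k[α+k]/2⌉ : ∀ α d → ⌈ (α + (α + d)) * (α + d) /2⌉ ≡ α * (α + d) + ⌈ (α + d) * d /2⌉
⌈k[α+k]/2⌉ α d = trans (cong ⌈_/2⌉ (expand α d)) (⌈m+m+n/2⌉ (α * (α + d)) ((α + d) * d))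
  where
  expand : ∀ α d → (α + (α + d)) * (α + d) ≡ α * (α + d) + α * (α + d) + (α + d) * d
  expand = solve-∀

-- With k = α + d and n = α + k one has nk = 2αk + kd, so the degree bound settles every d except 1.
-- There k = α + 1, and a maximum independent set is small enough to be deleted.
lower-bound : ∀ α d (G : Graph (α + (α + d))) → Connected[_] G (α + d) → IndependenceNumber G α →
  α * (α + d) + edgeNumber (α + d) d ≤ size G
lower-bound α 0 G conn _ = ≤-trans
  (+-monoʳ-≤ (α * (α + 0)) z≤n) (≤-trans (≤-reflexive (sym (⌈k[α+k]/2⌉ α 0))) (⌈nk/2⌉≤size G conn))
lower-bound α (suc (suc d)) G conn _ = ≤-trans
  (≤-reflexive (sym (⌈k[α+k]/2⌉ α (2 + d)))) (⌈nk/2⌉≤size G conn)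
lower-bound α 1 G conn ((S , indep , ∣S∣≡α) , _) = ≤-trans
  (+-mono-≤ (≤-reflexive (cong (_* (α + 1)) (sym ∣S∣≡α))) enough) (independent-size G S indep (k≤deg G conn))
  where
  -- Deleting `S` leaves a connected graph on α + 1 vertices, which needs α edges.
  rest : α + (α + 1) ≤ suc α + length (edgesOutside G S)
  rest = subst (λ s → α + (α + 1) ≤ suc s + length (edgesOutside G S)) ∣S∣≡α
    (connectedOutside⇒≤ G S (edgesOutside G S)
      (proj₂ conn S (≤-reflexive (trans (cong suc ∣S∣≡α) (+-comm 1 α)))) (edgesOutside-listed G S))
  enough : α + 1 ∸ 1 ≤ length (edgesOutside G S)
  enough = m≤n+o⇒m∸n≤o (α + 1) 1 (+-cancelˡ-≤ α _ _ (subst (α + (α + 1) ≤_) (sym (+-suc α _)) rest))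

-- The lower bound, applied to the constructed graph itself, turns the inequality between size and
-- list length into the equality required.
minimum : ∀ {n s} {P : Graph n → Set} → (∀ G → P G → s ≤ size G) →
  (L : List (Fin n × Fin n)) → P (fromList L) → length L ≤ s → MinimumSize P s
minimum lower L PL L≤s = (fromList L , PL , ≤-antisym (≤-trans (size-fromList-≤ L) L≤s) (lower _ PL)) , lower

f-value : ∀ α d → 2 ≤ α → f[ α + (α + d) , α , α + d ]= (α * (α + d) + edgeNumber (α + d) d)
f-value α d 2≤α = minimum (λ G P → lower-bound α d G (proj₁ P) (proj₂ P))
  -- No independent set exceeds n - k, and here n - k = α.
  joined (conn , independence-≥ , λ S indep → subst (∣ S ∣ ≤_) (m+n∸n≡m α (α + d)) (independent⇒≤n∸k G conn S λ {u} {v} → indep {u} {v}))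
  (≤-trans (≤-reflexive length-joined) (+-monoʳ-≤ (α * (α + d)) few))
  where
  open Sparse (sparse-graph (α + d) d (+-monoˡ-≤ d 2≤α))
  open Join α (α + d) edgeList
  conn : Connected[_] G (α + d)
  conn = join-connected α d (≤-trans (s≤s z≤n) 2≤α) edgeList connected

m-value : ∀ p d → 2 + d ≤ p → m[ p , d ]= edgeNumber p d
m-value p d 2+d≤p = minimum (edgeNumber-≤ d) edgeList connected few
  where open Sparse (sparse-graph p d 2+d≤p)

f-value-α≡k : ∀ α d → α ≡ α + d → α * (α + d) + edgeNumber (α + d) d ≡ (α + d) ^ 2
f-value-α≡k α zero    _  = eq α
  where
  eq : ∀ α → α * (α + 0) + 0 ≡ (α + 0) * ((α + 0) * 1)
  eq = solve-∀
f-value-α≡k α (suc d) eq = ⊥-elim (m≢1+m+n α (trans eq (+-suc α d)))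

-- Only d = 1 is consistent with the hypothesis. There `α + 1` is rewritten to `suc α`, so that both
-- truncated subtractions compute.
f-value-α≡k-1 : ∀ α d → 2 ≤ α → α ≡ α + d ∸ 1 → α * (α + d) + edgeNumber (α + d) d ≡ (α + d) ^ 2 ∸ 1
f-value-α≡k-1 (suc α) zero _ eq = ⊥-elim (1+n≢n (trans eq (+-identityʳ α)))
f-value-α≡k-1 α 1 _ _ rewrite +-comm α 1 = eq α
  where
  eq : ∀ α → α * suc α + α ≡ α * 1 + α * (suc α * 1)
  eq = solve-∀
f-value-α≡k-1 (suc α) (suc (suc d)) _ eq = ⊥-elim (m≢1+m+n (suc α) (trans eq (trans (+-suc α (suc d)) (cong suc (+-suc α d)))))

-- Matching α as `suc (suc α)` makes the truncated subtraction of 2 exact, which refutes d = 0 and d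
-- = 1; for d ≥ 2 the value is the degree bound.
f-value-α≤k-2 : ∀ α d → 2 ≤ α → α ≤ α + d ∸ 2 → α * (α + d) + edgeNumber (α + d) d ≡ ⌈ (α + d) * (α + (α + d)) /2⌉
f-value-α≤k-2 (suc (suc α)) zero _ le = ⊥-elim (<⇒≱ (m<n+m α {2} (s≤s z≤n)) (≤-trans le (≤-reflexive (+-identityʳ α))))
f-value-α≤k-2 (suc (suc α)) 1 _ le = ⊥-elim (<⇒≱ (n<1+n (suc α)) (≤-trans le (≤-reflexive (+-comm α 1))))
f-value-α≤k-2 α d@(suc (suc _)) _ _ = trans (sym (⌈k[α+k]/2⌉ α d)) (cong ⌈_/2⌉ (*-comm (α + (α + d)) (α + d)))

theorem3p1 : ∀ (α k : ℕ) → 2 ≤ α → 3 ≤ k → α ≤ k →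
    ∃₂ λ (f m : ℕ) →
    (f[ α + k , α , k ]= f) ×
    (m[ k , k ∸ α ]= m) ×
    (f ≡ α * k + m) ×
    (α ≡ k → f ≡ k ^ 2) ×
    (α ≡ k ∸ 1 → f ≡ k ^ 2 ∸ 1) ×
    (α ≤ k ∸ 2 → f ≡ ⌈ k * (α + k) /2⌉)
theorem3p1 α k 2≤α _ α≤k with m≤n⇒∃[o]m+o≡n α≤k
... | d , refl =
  α * (α + d) + edgeNumber (α + d) d , edgeNumber (α + d) d ,
  f-value α d 2≤α ,
  subst (m[ α + d ,_]= edgeNumber (α + d) d) (sym (m+n∸m≡n α d)) (m-value (α + d) d (+-monoˡ-≤ d 2≤α)) ,
  refl , f-value-α≡k α d , f-value-α≡k-1 α d 2≤α , f-value-α≤k-2 α d 2≤α
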